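{- Let $P(3,1)$ be the graph with vertex set $\{u_0,u_1,u_2,v_0,v_1,v_2\}$ and edges $u_iu_{i+1}$, $v_iv_{i+1}$, $u_iv_i$ ($i=0,1,2$, indices mod $3$). Up to switching isomorphism there are exactly six signed graphs on $P(3,1)$; i.e., the set of all signatures $\Sigma\subseteq E(P(3,1))$ falls into exactly six classes under switching isomorphism.
   Context: A signature of a graph $G$ is a subset $\Sigma\subseteq E(G)$ (the negative edges). Resigning at a vertex $v$ replaces $\Sigma$ by its symmetric difference with the set of edges incident with $v$; two signatures are switching equivalent if one is obtained from the other by a sequence of resignings. Two signatures $\Sigma_1,\Sigma_2$ of $G$ are switching isomorphic if there is an automorphism $\psi$ of $G$ such that $\psi(\Sigma_1)=\{\psi(x)\psi(y):xy\in\Sigma_1\}$ is switching equivalent to $\Sigma_2$. -}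

module Defs where

open import Data.Nat using (ℕ)
open import Data.Fin using (Fin; zero; suc; _≟_)
open import Data.Fin.Subset using (Subset; _∈_)
open import Data.Fin.Permutation using (Permutation′; _⟨$⟩ʳ_)
open import Data.Bool using (Bool; _∨_; _xor_)
open import Data.Vec using (Vec; zipWith; tabulate)
open import Data.Product using (Σ; ∃; _×_; _,_; proj₁; proj₂)
open import Data.Sum using (_⊎_)
open import Relation.Binary.PropositionalEquality using (_≡_)
open import Relation.Nullary.Decidable using (⌊_⌋)
open import Relation.Binary.Construct.Closure.ReflexiveTransitive using (Star)
open import Function.Bundles using (_⇔_)

V : Set
V = Fin 6

u₀ u₁ u₂ v₀ v₁ v₂ : V
u₀ = zero
u₁ = suc zero
u₂ = suc (suc zero)
v₀ = suc (suc (suc zero))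
v₁ = suc (suc (suc (suc zero)))
v₂ = suc (suc (suc (suc (suc zero))))

E : Set
E = Fin 9

ends : E → V × V
ends zero = u₀ , u₁
ends (suc zero) = u₁ , u₂
ends (suc (suc zero)) = u₂ , u₀
ends (suc (suc (suc zero))) = v₀ , v₁
ends (suc (suc (suc (suc zero)))) = v₁ , v₂
ends (suc (suc (suc (suc (suc zero))))) = v₂ , v₀
ends (suc (suc (suc (suc (suc (suc zero)))))) = u₀ , v₀
ends (suc (suc (suc (suc (suc (suc (suc zero))))))) = u₁ , v₁
ends (suc (suc (suc (suc (suc (suc (suc (suc zero)))))))) = u₂ , v₂

Joins : E → V → V → Set
Joins e x y = ends e ≡ (x , y) ⊎ ends e ≡ (y , x)

Adj : V → V → Set
Adj x y = ∃ λ e → Joins e x y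

-- A signature is a subset of E(P(3,1)) (the negative edges)
Signature : Set
Signature = Subset 9

incident : V → Signature
incident v = tabulate λ e → ⌊ v ≟ proj₁ (ends e) ⌋ ∨ ⌊ v ≟ proj₂ (ends e) ⌋

_△_ : Signature → Signature → Signature
_△_ = zipWith _xor_

resign : V → Signature → Signature
resign v Σ′ = Σ′ △ incident v

ResignStep : Signature → Signature → Set
ResignStep Σ₁ Σ₂ = ∃ λ v → Σ₂ ≡ resign v Σ₁

SwitchEq : Signature → Signature → Set
SwitchEq = Star ResignStep

IsAut : Permutation′ 6 → Set
IsAut ψ = ∀ x y → Adj x y ⇔ Adj (ψ ⟨$⟩ʳ x) (ψ ⟨$⟩ʳ y)

IsImage : Permutation′ 6 → Signature → Signature → Set
IsImage ψ Σ Σ′ = ∀ e e′ → Joins e′ (ψ ⟨$⟩ʳ proj₁ (ends e)) (ψ ⟨$⟩ʳ proj₂ (ends e))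
                        → (e ∈ Σ ⇔ e′ ∈ Σ′)

SwitchIso : Signature → Signature → Set
SwitchIso Σ₁ Σ₂ = Σ (Permutation′ 6) λ ψ → IsAut ψ ×
                   (∃ λ Σ′ → IsImage ψ Σ₁ Σ′ × SwitchEq Σ′ Σ₂)

{-# OPTIONS --safe #-}
-- Distinctness: let A_σ be the signed adjacency matrix of σ.  Resigning at a
-- vertex conjugates A_σ by a diagonal ±1 matrix and an automorphism conjugates
-- it by a permutation matrix, so the traces of its powers are invariants of
-- switching isomorphism.  The traces of A_σ³ and A_σ⁴ count the negative
-- triangles and the negative squares, which separates the six representatives.
--
-- Completeness: switching along a spanning tree makes its five edges positive;
-- up to the automorphism uᵢ ↦ vᵢ₊₁, vᵢ ↦ uᵢ₊₁ of order six, every signature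
-- normalised in this way is one of the representatives.
module Submission where

open import Defs
open import Data.Bool using (Bool; true; false; if_then_else_; _xor_)
import Data.Bool.Properties as Bool
open import Data.Fin using (Fin; toℕ; _≟_)
open import Data.Fin.Patterns
open import Data.Fin.Permutation as Perm
  using (Permutation′; permutation; _∘ₚ_; _⟨$⟩ʳ_; _⟨$⟩ˡ_; inverseˡ)
open import Data.Fin.Properties using (all?; any?)
open import Data.Fin.Subset using (_∈_; ⊥; ⁅_⁆; _∪_)
open import Data.Fin.Subset.Properties using (anySubset?)
open import Data.Integer using (ℤ; +_; -_; 0ℤ; 1ℤ; -1ℤ; _*_)
import Data.Integer.Properties as ℤ
open import Data.Integer.Tactic.RingSolver using (solve-∀)
open import Data.Nat using (ℕ; zero; suc)
open import Data.Product using (Σ; ∃; _×_; _,_; proj₁; proj₂)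
open import Data.Product.Properties using () renaming (≡-dec to ×-≡-dec)
open import Data.Sum using (inj₁; inj₂; swap)
open import Data.Vec using ([]; _∷_; lookup; tabulate)
open import Data.Vec.Properties
  using (≡-dec; lookup∘tabulate; lookup-zipWith; []=⇒lookup; lookup⇒[]=)
open import Function using (_∘_; _⇔_; mk⇔; Equivalence)
open import Function.Properties.Equivalence using ()
  renaming (refl to ⇔-refl; trans to ⇔-trans)
open import Relation.Binary.Construct.Closure.ReflexiveTransitive
  using (ε; _◅_; _◅◅_)
open import Relation.Binary.PropositionalEquality
open import Relation.Nullary using (Dec; yes; no; contradiction)
open import Relation.Nullary.Decidable
  using (⌊_⌋; from-yes; ¬?; decidable-stable; _×-dec_; _⊎-dec_; _→-dec_)
open import Algebra.Properties.Semiring.Sum ℤ.+-*-semiring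
  using (sum; sum-cong-≗; sum-permute; *-distribˡ-sum; *-distribʳ-sum)

-- Decision procedures, and membership as lookup.

joins? : ∀ e x y → Dec (Joins e x y)
joins? e x y = ×-≡-dec _≟_ _≟_ (ends e) (x , y) ⊎-dec ×-≡-dec _≟_ _≟_ (ends e) (y , x)

adj? : ∀ x y → Dec (Adj x y)
adj? x y = any? λ e → joins? e x y

_≟ˢ_ : (σ τ : Signature) → Dec (σ ≡ τ)
_≟ˢ_ = ≡-dec Bool._≟_

∈-⇔⇒lookup≡ : ∀ {e e′} {σ τ : Signature} → e ∈ σ ⇔ e′ ∈ τ → lookup σ e ≡ lookup τ e′
∈-⇔⇒lookup≡ {e} {e′} {σ} {τ} e⇔e′ with lookup σ e in p | lookup τ e′ in q
... | true  | true  = refl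
... | false | false = refl
... | true  | false =
  trans (sym ([]=⇒lookup (Equivalence.to e⇔e′ (lookup⇒[]= e σ p)))) q
... | false | true  =
  trans (sym p) ([]=⇒lookup (Equivalence.from e⇔e′ (lookup⇒[]= e′ τ q)))

lookup≡⇒∈-⇔ : ∀ {e e′} {σ τ : Signature} → lookup σ e ≡ lookup τ e′ → e ∈ σ ⇔ e′ ∈ τ
lookup≡⇒∈-⇔ {e} {e′} {σ} {τ} eq = mk⇔
  (λ e∈σ → lookup⇒[]= e′ τ (trans (sym eq) ([]=⇒lookup e∈σ)))
  (λ e′∈τ → lookup⇒[]= e σ (trans eq ([]=⇒lookup e′∈τ)))

-- Traces of powers of the signed adjacency matrix

sign : Bool → ℤ
sign negative = if negative then -1ℤ else 1ℤ

sign-xor : ∀ a b → sign (a xor b) ≡ sign a * sign b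
sign-xor false false = refl
sign-xor false true  = refl
sign-xor true  false = refl
sign-xor true  true  = refl

sign-cancel : ∀ b a → (sign b * sign b) * a ≡ a
sign-cancel false = ℤ.*-identityˡ
sign-cancel true  = ℤ.*-identityˡ

-- The sign is read off the edge carried by the decision; as the graph has no parallel edges, that
-- edge is determined by its ends.
entry : Signature → ∀ {x y} → Dec (Adj x y) → ℤ
entry σ (yes (e , _)) = sign (lookup σ e)
entry σ (no _)        = 0ℤ

adjacency : Signature → V → V → ℤ
adjacency σ x y = entry σ (adj? x y)

power : ℕ → Signature → V → V → ℤ
power zero    σ x y = adjacency σ x y
power (suc n) σ x y = sum λ z → adjacency σ x z * power n σ z y

-- The exponent is shifted: this is the trace of the (n + 1)-st power.
trace : ℕ → Signature → ℤ
trace n σ = sum λ x → power n σ x x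

diag : V → V → ℤ
diag v x = sign ⌊ v ≟ x ⌋

-- `incident` is a disjunction over the two ends, while the product of signs is an exclusive or;
-- they agree because no edge is a loop.
sign-incident : ∀ v e →
  sign (lookup (incident v) e) ≡ diag v (proj₁ (ends e)) * diag v (proj₂ (ends e))
sign-incident = from-yes (all? λ v → all? λ e →
  sign (lookup (incident v) e) ℤ.≟ diag v (proj₁ (ends e)) * diag v (proj₂ (ends e)))

adjacency-resign : ∀ v σ x y →
  adjacency (resign v σ) x y ≡ diag v x * adjacency σ x y * diag v y
adjacency-resign v σ x y with adj? x y
... | no _ = zeros (diag v x) (diag v y)
  where
  zeros : ∀ s t → 0ℤ ≡ s * 0ℤ * t
  zeros = solve-∀
... | yes (e , e-joins) = begin
  sign (lookup (resign v σ) e)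
    ≡⟨ cong sign (lookup-zipWith _xor_ e σ (incident v)) ⟩
  sign (lookup σ e xor lookup (incident v) e)
    ≡⟨ sign-xor (lookup σ e) _ ⟩
  a * sign (lookup (incident v) e)
    ≡⟨ cong (a *_) (incident-ends e-joins) ⟩
  a * (diag v x * diag v y)
    ≡⟨ rearrange a (diag v x) (diag v y) ⟩
  diag v x * a * diag v y ∎
  where
  open ≡-Reasoning
  a = sign (lookup σ e)
  rearrange : ∀ a s t → a * (s * t) ≡ s * a * t
  rearrange = solve-∀
  incident-ends : Joins e x y → sign (lookup (incident v) e) ≡ diag v x * diag v y
  incident-ends (inj₁ eq) = trans (sign-incident v e)
    (cong (λ p → diag v (proj₁ p) * diag v (proj₂ p)) eq)
  incident-ends (inj₂ eq) = trans (sign-incident v e) (trans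
    (cong (λ p → diag v (proj₁ p) * diag v (proj₂ p)) eq) (ℤ.*-comm (diag v y) (diag v x)))

-- Conjugation passes to powers because the diagonal sign matrix is its own inverse: the two factors
-- `d z` at the intermediate vertex cancel.
power-resign : ∀ n v σ x y →
  power n (resign v σ) x y ≡ diag v x * power n σ x y * diag v y
power-resign zero    v σ x y = adjacency-resign v σ x y
power-resign (suc n) v σ x y = begin
  (sum λ z → adjacency (resign v σ) x z * power n (resign v σ) z y)
    ≡⟨ sum-cong-≗ term ⟩
  (sum λ z → d x * (adjacency σ x z * power n σ z y) * d y)
    ≡⟨ *-distribʳ-sum (d y) (λ z → d x * (adjacency σ x z * power n σ z y)) ⟨
  sum (λ z → d x * (adjacency σ x z * power n σ z y)) * d y
    ≡⟨ cong (_* d y) (*-distribˡ-sum (d x) (λ z → adjacency σ x z * power n σ z y)) ⟨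
  d x * power (suc n) σ x y * d y ∎
  where
  open ≡-Reasoning
  d = diag v
  rearrange : ∀ s a t b u → (s * a * t) * (t * b * u) ≡ (t * t) * (s * (a * b) * u)
  rearrange = solve-∀
  term : ∀ z → adjacency (resign v σ) x z * power n (resign v σ) z y
             ≡ d x * (adjacency σ x z * power n σ z y) * d y
  term z = begin
    adjacency (resign v σ) x z * power n (resign v σ) z y
      ≡⟨ cong₂ _*_ (adjacency-resign v σ x z) (power-resign n v σ z y) ⟩
    (d x * adjacency σ x z * d z) * (d z * power n σ z y * d y)
      ≡⟨ rearrange (d x) _ (d z) _ (d y) ⟩
    (d z * d z) * (d x * (adjacency σ x z * power n σ z y) * d y)
      ≡⟨ sign-cancel ⌊ v ≟ z ⌋ _ ⟩
    d x * (adjacency σ x z * power n σ z y) * d y ∎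

trace-resign : ∀ n v σ → trace n (resign v σ) ≡ trace n σ
trace-resign n v σ = sum-cong-≗ λ x → begin
  power n (resign v σ) x x                ≡⟨ power-resign n v σ x x ⟩
  diag v x * power n σ x x * diag v x     ≡⟨ rearrange (diag v x) _ ⟩
  (diag v x * diag v x) * power n σ x x   ≡⟨ sign-cancel ⌊ v ≟ x ⌋ _ ⟩
  power n σ x x                           ∎
  where
  open ≡-Reasoning
  rearrange : ∀ s a → s * a * s ≡ (s * s) * a
  rearrange = solve-∀

trace-switchEq : ∀ n {σ τ} → SwitchEq σ τ → trace n σ ≡ trace n τ
trace-switchEq n ε = refl
trace-switchEq n {σ} ((v , refl) ◅ steps) =
  trans (sym (trace-resign n v σ)) (trace-switchEq n steps)

-- `IsImage` refers to the order in which `ends` lists the two vertices, whereas an adjacency may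
-- supply the edge in either orientation.
Joins-map : ∀ (f : V → V) {e e′ x y} → Joins e x y → Joins e′ (f x) (f y) →
            Joins e′ (f (proj₁ (ends e))) (f (proj₂ (ends e)))
Joins-map f {e′ = e′} (inj₁ eq) j =
  subst (λ p → Joins e′ (f (proj₁ p)) (f (proj₂ p))) (sym eq) j
Joins-map f {e′ = e′} (inj₂ eq) j =
  subst (λ p → Joins e′ (f (proj₁ p)) (f (proj₂ p))) (sym eq) (swap j)

module _ {ψ σ τ} (aut : IsAut ψ) (image : IsImage ψ σ τ) where

  adjacency-image : ∀ x y → adjacency σ x y ≡ adjacency τ (ψ ⟨$⟩ʳ x) (ψ ⟨$⟩ʳ y)
  adjacency-image x y with adj? x y | adj? (ψ ⟨$⟩ʳ x) (ψ ⟨$⟩ʳ y)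
  ... | yes (e , j) | yes (e′ , j′) =
    cong sign (∈-⇔⇒lookup≡ (image e e′ (Joins-map (ψ ⟨$⟩ʳ_) j j′)))
  ... | no _  | no _  = refl
  ... | yes p | no ¬q = contradiction (Equivalence.to (aut x y) p) ¬q
  ... | no ¬p | yes q = contradiction (Equivalence.from (aut x y) q) ¬p

  power-image : ∀ n x y → power n σ x y ≡ power n τ (ψ ⟨$⟩ʳ x) (ψ ⟨$⟩ʳ y)
  power-image zero    x y = adjacency-image x y
  power-image (suc n) x y = trans
    (sum-cong-≗ λ z → cong₂ _*_ (adjacency-image x z) (power-image n z y))
    -- Reindexes the sum over intermediate vertices along `ψ`.
    (sym (sum-permute (λ z → adjacency τ (ψ ⟨$⟩ʳ x) z * power n τ z (ψ ⟨$⟩ʳ y)) ψ))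

  trace-image : ∀ n → trace n σ ≡ trace n τ
  trace-image n = trans
    (sum-cong-≗ λ x → power-image n x x)
    (sym (sum-permute (λ x → power n τ x x) ψ))

trace-switchIso : ∀ n {σ τ} → SwitchIso σ τ → trace n σ ≡ trace n τ
trace-switchIso n (ψ , aut , _ , image , steps) =
  trans (trace-image {ψ} aut image n) (trace-switchEq n steps)

-- Reduction to the representatives

clear : E → V → Signature → Signature
clear e v σ = if lookup σ e then resign v σ else σ

switchEq-clear : ∀ e v σ → SwitchEq σ (clear e v σ)
switchEq-clear e v σ with lookup σ e
... | true  = (v , refl) ◅ ε
... | false = ε

-- The spanning tree consists of u₀u₁, u₂u₀ and the three spokes uᵢvᵢ; resigning
-- at the endpoint farther from u₀ does not disturb the tree edges already cleared.
normalise : Signature → Signature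
normalise = clear 8F v₂ ∘ clear 7F v₁ ∘ clear 6F v₀ ∘ clear 2F u₂ ∘ clear 0F u₁

switchEq-normalise : ∀ σ → SwitchEq σ (normalise σ)
switchEq-normalise σ =
  switchEq-clear 0F u₁ σ ◅◅ switchEq-clear 2F u₂ _ ◅◅ switchEq-clear 6F v₀ _ ◅◅
  switchEq-clear 7F v₁ _ ◅◅ switchEq-clear 8F v₂ _

-- The automorphism of order six.

iterate₆ : ∀ {A : Set} → (A → A) → A → A
iterate₆ f = f ∘ f ∘ f ∘ f ∘ f ∘ f

iterate₆-id? : ∀ {n} (f : Fin n → Fin n) → Dec (∀ x → iterate₆ f x ≡ x)
iterate₆-id? f = all? λ x → iterate₆ f x ≟ x

-- The inverse is the fifth iterate, so both inverse laws unfold to the same identity.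
cyclic₆ : ∀ {n} (f : Fin n → Fin n) → (∀ x → iterate₆ f x ≡ x) → Permutation′ n
cyclic₆ f f⁶≡id = permutation f (f ∘ f ∘ f ∘ f ∘ f) f⁶≡id f⁶≡id

turnⱽ : Permutation′ 6
turnⱽ = cyclic₆ f (from-yes (iterate₆-id? f))
  where f = lookup (v₁ ∷ v₂ ∷ v₀ ∷ u₁ ∷ u₂ ∷ u₀ ∷ [])

-- The action of `turnⱽ` on edges in the numbering of `ends`, as `turn-Joins` confirms.
turnᴱ : Permutation′ 9
turnᴱ = cyclic₆ f (from-yes (iterate₆-id? f))
  where f = lookup (4F ∷ 5F ∷ 3F ∷ 1F ∷ 2F ∷ 0F ∷ 7F ∷ 8F ∷ 6F ∷ [])

turn : Signature → Signature
turn σ = tabulate λ e → lookup σ (turnᴱ ⟨$⟩ˡ e)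

lookup-turn : ∀ σ e → lookup σ e ≡ lookup (turn σ) (turnᴱ ⟨$⟩ʳ e)
lookup-turn σ e = sym (trans
  (lookup∘tabulate (λ e′ → lookup σ (turnᴱ ⟨$⟩ˡ e′)) (turnᴱ ⟨$⟩ʳ e))
  (cong (lookup σ) (inverseˡ turnᴱ)))

turn-Joins : ∀ e → Joins (turnᴱ ⟨$⟩ʳ e) (turnⱽ ⟨$⟩ʳ proj₁ (ends e)) (turnⱽ ⟨$⟩ʳ proj₂ (ends e))
turn-Joins = from-yes (all? λ e →
  joins? (turnᴱ ⟨$⟩ʳ e) (turnⱽ ⟨$⟩ʳ proj₁ (ends e)) (turnⱽ ⟨$⟩ʳ proj₂ (ends e)))

turn-isAut : IsAut turnⱽ
turn-isAut x y = mk⇔ (proj₁ (both x y)) (proj₂ (both x y))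
  where
  turned? : ∀ x y → Dec (Adj (turnⱽ ⟨$⟩ʳ x) (turnⱽ ⟨$⟩ʳ y))
  turned? x y = adj? (turnⱽ ⟨$⟩ʳ x) (turnⱽ ⟨$⟩ʳ y)
  both : ∀ x y → (Adj x y → Adj (turnⱽ ⟨$⟩ʳ x) (turnⱽ ⟨$⟩ʳ y)) ×
                 (Adj (turnⱽ ⟨$⟩ʳ x) (turnⱽ ⟨$⟩ʳ y) → Adj x y)
  both = from-yes (all? λ x → all? λ y →
    (adj? x y →-dec turned? x y) ×-dec (turned? x y →-dec adj? x y))

-- The graph is simple, so under the identity permutation an edge can only be its own image.
Joins-unique : ∀ e e′ → Joins e′ (proj₁ (ends e)) (proj₂ (ends e)) → e ≡ e′
Joins-unique = from-yes (all? λ e → all? λ e′ →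
  joins? e′ (proj₁ (ends e)) (proj₂ (ends e)) →-dec e ≟ e′)

switchEq⇒switchIso : ∀ {σ τ} → SwitchEq σ τ → SwitchIso σ τ
switchEq⇒switchIso {σ} steps =
  Perm.id , (λ _ _ → ⇔-refl) , σ ,
  (λ e e′ j → subst (λ e″ → e ∈ σ ⇔ e″ ∈ σ) (Joins-unique e e′ j) ⇔-refl) , steps

turn-switchIso : ∀ {σ τ} → SwitchIso (turn σ) τ → SwitchIso σ τ
turn-switchIso {σ} (ψ , aut , σ′ , image , steps) =
  turnⱽ ∘ₚ ψ , (λ x y → ⇔-trans (turn-isAut x y) (aut _ _)) , σ′ ,
  (λ e e′ j → ⇔-trans
    (lookup≡⇒∈-⇔ (lookup-turn σ e))
    (image (turnᴱ ⟨$⟩ʳ e) e′ (Joins-map (ψ ⟨$⟩ʳ_) (turn-Joins e) j))) ,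
  steps

turns : ℕ → Signature → Signature
turns zero    σ = σ
turns (suc k) σ = turns k (turn σ)

-- All turns precede the resignings, as in `SwitchIso`, so no resigning has to be carried through an
-- automorphism.
turns-switchIso : ∀ k {σ τ} → SwitchEq (turns k σ) τ → SwitchIso σ τ
turns-switchIso zero    steps = switchEq⇒switchIso steps
turns-switchIso (suc k) steps = turn-switchIso (turns-switchIso k steps)

-- The numbers of (negative triangles, negative squares) are
-- (0,0), (1,1), (0,2), (1,3), (2,0) and (2,2), in this order.
representative : Fin 6 → Signature
representative = lookup
  ( ⊥
  ∷ ⁅ 3F ⁆
  ∷ ⁅ 3F ⁆ ∪ ⁅ 4F ⁆
  ∷ ⁅ 3F ⁆ ∪ ⁅ 4F ⁆ ∪ ⁅ 5F ⁆
  ∷ ⁅ 1F ⁆ ∪ ⁅ 4F ⁆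
  ∷ ⁅ 1F ⁆ ∪ ⁅ 3F ⁆
  ∷ [])

-- With m negative triangles and k negative squares, tr A³ = 6 (2 − 2m) and
-- tr A⁴ = 90 + 8 (3 − 2k), where 90 counts the closed 4-walks not around a square.
tr³ tr⁴ : Fin 6 → ℤ
tr³ = lookup (+ 12 ∷ + 0 ∷ + 12 ∷ + 0 ∷ - + 12 ∷ - + 12 ∷ [])
tr⁴ = lookup (+ 114 ∷ + 98 ∷ + 82 ∷ + 66 ∷ + 114 ∷ + 82 ∷ [])

trace-2 : ∀ i → trace 2 (representative i) ≡ tr³ i
trace-2 = from-yes (all? λ i → trace 2 (representative i) ℤ.≟ tr³ i)

trace-3 : ∀ i → trace 3 (representative i) ≡ tr⁴ i
trace-3 = from-yes (all? λ i → trace 3 (representative i) ℤ.≟ tr⁴ i)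

tr-injective : ∀ i j → tr³ i ≡ tr³ j → tr⁴ i ≡ tr⁴ j → i ≡ j
tr-injective = from-yes (all? λ i → all? λ j →
  tr³ i ℤ.≟ tr³ j →-dec tr⁴ i ℤ.≟ tr⁴ j →-dec i ≟ j)

switchIso-injective : ∀ i j → SwitchIso (representative i) (representative j) → i ≡ j
switchIso-injective i j iso = tr-injective i j
  (trans (sym (trace-2 i)) (trans (trace-switchIso 2 iso) (trace-2 j)))
  (trans (sym (trace-3 i)) (trans (trace-switchIso 3 iso) (trace-3 j)))

-- Literal equality can be asked for: normalised signatures and representatives alike live on the
-- four non-tree edges `1F`, `3F`, `4F`, `5F`. The index `k` covers the whole cyclic group generated
-- by the turn.
Reducible : Signature → Set
Reducible σ = ∃ λ (k : Fin 6) → ∃ λ i → normalise (turns (toℕ k) σ) ≡ representative i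

reducible? : ∀ σ → Dec (Reducible σ)
reducible? σ = any? λ k → any? λ i → normalise (turns (toℕ k) σ) ≟ˢ representative i

-- A search through all 512 signatures finds no irreducible one; decidability then removes the
-- double negation.
reducible : ∀ σ → Reducible σ
reducible σ = decidable-stable (reducible? σ) λ ¬r →
  from-yes (¬? (anySubset? (¬? ∘ reducible?))) (σ , ¬r)

reducible⇒switchIso : ∀ {σ} → Reducible σ → ∃ λ i → SwitchIso σ (representative i)
reducible⇒switchIso {σ} (k , i , eq) =
  i , turns-switchIso (toℕ k) (subst (SwitchEq σ′) eq (switchEq-normalise σ′))
  where σ′ = turns (toℕ k) σ

theorem6 : Σ (Fin 6 → Signature) λ rep →
    ((i j : Fin 6) → SwitchIso (rep i) (rep j) → i ≡ j) ×
    ((σ : Signature) → ∃ λ i → SwitchIso σ (rep i))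
theorem6 =
  representative ,
  switchIso-injective ,
  (λ σ → reducible⇒switchIso (reducible σ))
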